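{- Every countable meet-continuous $L$-dcpo $P$ admits a countable family of directed subsets of $P$ that is complete for Scott openness. Consequently, for every finite family $P_1,\ldots,P_n$ of countable meet-continuous $L$-dcpos, \[ \sigma\Bigl(\prod_{i=1}^{n}P_i\Bigr)=\prod_{i=1}^{n}\sigma(P_i). \] No global least elements are assumed.
   Context: All posets and directed sets are nonempty; countable sets may be finite. A subset $D$ of a poset is directed if any two of its elements have a common upper bound in $D$. A dcpo is a poset in which every directed subset has a supremum. Write $\mathord{\downarrow}x=\{y:y\le x\}$ and $\mathord{\downarrow}A=\bigcup_{a\in A}\mathord{\downarrow}a$; sets of the form $\mathord{\downarrow}x$ are called principal ideals. For a dcpo $P$, an upper set $U\subseteq P$ is Scott open if for every directed $D\subseteq P$, $\bigvee D\in U$ implies $D\cap U\neq\emptyset$; the Scott open sets form the Scott topology $\sigma(P)$. A dcpo $P$ is meet-continuous if for every $x\in P$ and every directed $D\subseteq P$, $x\le\bigvee D$ implies $x\in\operatorname{cl}_{\sigma(P)}(\mathord{\downarrow}x\cap\mathord{\downarrow}D)$, where $\operatorname{cl}_{\sigma(P)}$ is closure in the Scott topology. A dcpo $P$ is an $L$-dcpo if every principal ideal $\mathord{\downarrow}r$, $r\in P$, is a complete lattice in its induced order (suprema and infima of all subsets, including the empty one, exist inside $\mathord{\downarrow}r$). A global least element is not required. A family $\mathcal D$ of directed subsets of a dcpo $P$ is complete for Scott openness if an upper set $U\subseteq P$ is Scott open exactly when, for every $D\in\mathcal D$, $\bigvee D\in U$ implies $D\cap U\neq\emptyset$. $\prod_i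 P_i$ carries the coordinatewise order, $\sigma(\prod_i P_i)$ is its Scott topology, and $\prod_i\sigma(P_i)$ denotes the ordinary topological product of the Scott topologies. -}

module Defs where

open import Data.Nat.Base using (ℕ)
open import Data.Fin.Base using (Fin)
open import Data.Product.Base using (_×_; _,_; proj₁; proj₂; ∃)
open import Function.Bundles using (Injection; _⇔_)
open import Level using (Level; suc; _⊔_)
open import Relation.Binary.Bundles using (Setoid; Poset)
open import Relation.Binary.Construct.On as On using ()
open import Relation.Binary.Indexed.Homogeneous using (IndexedPoset)
open import Relation.Binary.PropositionalEquality using (_≡_; refl; setoid)
open import Relation.Unary using (Pred; _∈_; _⊆_; _∩_; _≬_; ∁; Satisfiable)

-- Injecting into ℕ, rather than being enumerated, so finite sets qualify.
Countable : ∀ {a b} → Setoid a b → Set (a ⊔ b)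
Countable S = Injection S (setoid ℕ)

-- Subsets are predicates and need not respect _≈_.  This loses nothing: a
-- subset and its _≈_-saturation have the same bounds and lower closure and
-- meet the same upper sets, and upper sets always respect _≈_.  Fixing their
-- level at ℓ is harmless under excluded middle, which resizes every subset.
module _ {ℓ : Level} (P : Poset ℓ ℓ ℓ) where
  open Poset P

  UpperBound : Pred Carrier ℓ → Pred Carrier ℓ
  UpperBound A u = ∀ {a} → a ∈ A → a ≤ u

  LowerBound : Pred Carrier ℓ → Pred Carrier ℓ
  LowerBound A l = ∀ {a} → a ∈ A → l ≤ a

  IsSup : Pred Carrier ℓ → Pred Carrier ℓ
  IsSup A s = s ∈ UpperBound A × (∀ {u} → u ∈ UpperBound A → s ≤ u)

  IsInf : Pred Carrier ℓ → Pred Carrier ℓ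
  IsInf A m = m ∈ LowerBound A × (∀ {l} → l ∈ LowerBound A → l ≤ m)

  IsUpperSet : Pred Carrier ℓ → Set ℓ
  IsUpperSet U = ∀ {x y} → x ≤ y → x ∈ U → y ∈ U

  IsDirected : Pred Carrier ℓ → Set ℓ
  IsDirected D =
    Satisfiable D ×
    (∀ {x y} → x ∈ D → y ∈ D → ∃ λ z → z ∈ D × x ≤ z × y ≤ z)

  ↓_ : Carrier → Pred Carrier ℓ
  (↓ x) y = y ≤ x

  ↓ˢ_ : Pred Carrier ℓ → Pred Carrier ℓ
  (↓ˢ A) y = ∃ λ a → a ∈ A × y ∈ ↓ a

  IsCompleteLattice : Set (suc ℓ)
  IsCompleteLattice =
    (A : Pred Carrier ℓ) → ∃ (IsSup A) × ∃ (IsInf A)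

  principalIdeal : Carrier → Poset ℓ ℓ ℓ
  principalIdeal r = On.poset {B = ∃ (_∈ ↓ r)} P proj₁

record DCPO (ℓ : Level) : Set (suc ℓ) where
  field
    poset    : Poset ℓ ℓ ℓ
    nonempty : Poset.Carrier poset
    dirSup   : (D : Pred (Poset.Carrier poset) ℓ) →
               IsDirected poset D → ∃ (IsSup poset D)

  open Poset poset public

  ⋁ : (D : Pred Carrier ℓ) → IsDirected poset D → Carrier
  ⋁ D dir = proj₁ (dirSup D dir)

-- A topology is represented by its collection of open sets.
Opens : ∀ {ℓ} → Set ℓ → Set (suc (suc ℓ))
Opens {ℓ} X = Pred (Pred X ℓ) (suc ℓ)

closure : ∀ {ℓ} {X : Set ℓ} → Opens X → Pred X ℓ → Pred X (suc ℓ)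
closure τ A x = ∀ C → ∁ C ∈ τ → A ⊆ C → x ∈ C

-- The open boxes ∏ Vᵢ form a basis because the family is finite.
productTopology : ∀ {ℓ n} {X : Fin n → Set ℓ} →
                  (∀ i → Opens (X i)) → Opens (∀ i → X i)
productTopology {ℓ} {X = X} τ W = ∀ {x} → x ∈ W →
  ∃ λ (V : ∀ i → Pred (X i) ℓ) →
    (∀ i → V i ∈ τ i) ×
    (∀ i → x i ∈ V i) ×
    (∀ {y} → (∀ i → y i ∈ V i) → y ∈ W)

module _ {ℓ : Level} (P : DCPO ℓ) where
  open DCPO P

  σ : Opens Carrier
  σ U = IsUpperSet poset U ×
        (∀ D (dir : IsDirected poset D) → ⋁ D dir ∈ U → D ≬ U)

  IsMeetContinuous : Set (suc ℓ)
  IsMeetContinuous =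
    ∀ x D (dir : IsDirected poset D) → x ≤ ⋁ D dir →
    x ∈ closure σ ((↓_ poset x) ∩ (↓ˢ_ poset D))

  IsLDCPO : Set (suc ℓ)
  IsLDCPO = ∀ r → IsCompleteLattice (principalIdeal poset r)

  IsCompleteForScottOpenness :
    {I : Set} (𝒟 : I → ∃ (IsDirected poset)) → Set (suc ℓ)
  IsCompleteForScottOpenness 𝒟 =
    ∀ U → IsUpperSet poset U →
    U ∈ σ ⇔
    (∀ i → let (D , dir) = 𝒟 i in ⋁ D dir ∈ U → D ≬ U)

  HasCountableCompleteFamily : Set (suc ℓ)
  HasCountableCompleteFamily =
    ∃ λ (I : Set) → Countable (setoid I) ×
    ∃ λ (𝒟 : I → ∃ (IsDirected poset)) → IsCompleteForScottOpenness 𝒟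

record IsCountableMeetContinuousLDCPO {ℓ : Level} (P : DCPO ℓ) : Set (suc ℓ) where
  field
    countable      : Countable (Poset.Eq.setoid (DCPO.poset P))
    meetContinuous : IsMeetContinuous P
    isLDCPO        : IsLDCPO P

∏ᵖ : ∀ {ℓ} {I : Set} → (I → Poset ℓ ℓ ℓ) → Poset ℓ ℓ ℓ
∏ᵖ {ℓ} {I} P = IndexedPoset.poset coordinatewise
  where
  coordinatewise : IndexedPoset I ℓ ℓ ℓ
  coordinatewise = record
    { Carrierᵢ        = λ i → Poset.Carrier (P i)
    ; _≈ᵢ_            = λ {i} → Poset._≈_ (P i)
    ; _≤ᵢ_            = λ {i} → Poset._≤_ (P i)
    ; isPartialOrderᵢ = record
      { isPreorderᵢ = record
        { isEquivalenceᵢ = record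
          { reflᵢ  = λ {i} → Poset.Eq.refl (P i)
          ; symᵢ   = λ {i} → Poset.Eq.sym (P i)
          ; transᵢ = λ {i} → Poset.Eq.trans (P i)
          }
        ; reflexiveᵢ = λ {i} → Poset.reflexive (P i)
        ; transᵢ     = λ {i} → Poset.trans (P i)
        }
      ; antisymᵢ = λ {i} → Poset.antisym (P i)
      }
    }

∏ : ∀ {ℓ} {I : Set} → (I → DCPO ℓ) → DCPO ℓ
∏ {ℓ} {I} P = record
  { poset    = ∏ᵖ (λ i → DCPO.poset (P i))
  ; nonempty = λ i → DCPO.nonempty (P i)
  ; dirSup   = λ D dir →
      (λ i → DCPO.⋁ (P i) (proj D i) (proj-directed D dir i)) ,
      (λ d∈D i → proj₁ (isSup D dir i) (_ , d∈D , refl)) ,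
      (λ ub i → proj₂ (isSup D dir i) λ { (_ , d∈D , refl) → ub d∈D i })
  }
  where
  Q : Poset ℓ ℓ ℓ
  Q = ∏ᵖ (λ i → DCPO.poset (P i))

  proj : Pred (Poset.Carrier Q) ℓ → ∀ i → Pred (DCPO.Carrier (P i)) ℓ
  proj D i a = ∃ λ d → d ∈ D × d i ≡ a

  proj-directed : ∀ D → IsDirected Q D → ∀ i →
                  IsDirected (DCPO.poset (P i)) (proj D i)
  proj-directed D ((d , d∈D) , ub) i =
    (d i , d , d∈D , refl) ,
    λ { (x , x∈D , refl) (y , y∈D , refl) →
        let (z , z∈D , x≤z , y≤z) = ub x∈D y∈D
        in z i , (z , z∈D , refl) , x≤z i , y≤z i }

  isSup : ∀ D (dir : IsDirected Q D) i →
          IsSup (DCPO.poset (P i)) (proj D i)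
                (DCPO.⋁ (P i) (proj D i) (proj-directed D dir i))
  isSup D dir i = proj₂ (DCPO.dirSup (P i) (proj D i) (proj-directed D dir i))

{-# OPTIONS --safe #-}
module Submission where

-- First claim.  Let U be an upper set missing a directed set D with x = ⋁D ∈ U.
-- By meet-continuity every b ≤ x is the supremum of ↓b ∩ ↓D, which is directed
-- since binary meets exist inside ↓x.  Some interval [g , b] with g ∈ ↓D and
-- b ∈ U meets U only in b: otherwise every such interval contains some
-- c ∈ U strictly below b, hence two disjoint such intervals, [g , c] and
-- [g′ , b] with g′ ∈ ↓D not below c.  Shrinking intervals so as to avoid the
-- n-th element of P at step n, the supremum of the lower ends would be an
-- element missing from the enumeration.  For that g and b, any directed
-- subset of [g , b] with supremum b but not reaching b misses U, so it suffices
-- to choose one such set for every pair (g , b).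
--
-- Second claim.  Around a point of a Scott open set U of the product, grow
-- finite sets Aᵢ with ∏ ↑Aᵢ ⊆ U, treating every set D of the i-th family
-- infinitely often: when ⋁D ∈ ↑Aᵢ, some d ∈ D may be added to Aᵢ because only
-- finitely many minimal points of the other factors matter.  The unions in the
-- limit are Scott open by completeness of the families.

open import Defs
open import Axiom.ExcludedMiddle using (ExcludedMiddle)
open import Data.Fin.Base using (Fin; zero; suc)
open import Data.Fin.Properties using (_≟_; ∀-cons)
open import Data.List.Base using (List; []; _∷_; [_]; lookup; upTo; allFin; cartesianProduct)
open import Data.List.Membership.Propositional renaming (_∈_ to _∈ˡ_) using ()
open import Data.List.Membership.Propositional.Properties
  using (∈-cartesianProduct⁺; ∈-upTo⁺; ∈-allFin; ∈-lookup)
open import Data.List.Relation.Unary.Any as Any using (Any; here; there; index)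
open import Data.List.Relation.Unary.Any.Properties using (lookup-index; singleton⁻)
open import Data.Nat.Base as ℕ using (ℕ; zero; suc; _+_; _*_; _⊔_; _≤′_; ≤′-refl; ≤′-step)
open import Data.Nat.Properties as ℕ using (≤⇒≤′; m≤m⊔n; m≤n⊔m)
open import Data.Product.Base using (_×_; _,_; proj₁; proj₂; ∃; map₂)
open import Data.Sum.Base using (_⊎_; inj₁; inj₂)
open import Data.Unit.Base using (tt)
open import Function.Base using (_∘_; id)
open import Function.Bundles using (Injection; mk⇔; Equivalence)
open import Level using (Level)
open import Relation.Binary.Bundles using (Poset)
open import Relation.Binary.Core using (Rel)
open import Relation.Binary.Definitions using (Reflexive; Transitive; tri<; tri≈; tri>)
open import Relation.Binary.PropositionalEquality
  using (_≡_; _≢_; refl; sym; trans; cong; cong₂; subst; setoid)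
open import Relation.Nullary.Decidable using (yes; no; decidable-stable)
open import Relation.Nullary.Negation using (¬_; contradiction)
open import Relation.Unary using (Pred; _∈_; _⊆_; _≬_; ∁; U; Satisfiable; _≐_)

private
  variable
    a p r : Level
    A : Set a
    n : ℕ

-- Monotone sequences, finite upper bounds and pairing of natural numbers.

step-monotone : (_∼_ : Rel A r) → Reflexive _∼_ → Transitive _∼_ →
                (f : ℕ → A) → (∀ k → f k ∼ f (suc k)) →
                ∀ {k l} → k ≤′ l → f k ∼ f l
step-monotone _∼_ rfl trn f step {k} ≤′-refl = rfl {f k}
step-monotone _∼_ rfl trn f step {k} (≤′-step {n = l} k≤l) =
  trn {f k} {f l} {f (suc l)}
    (step-monotone _∼_ (λ {s} → rfl {s}) (λ {s} {t} {u} → trn {s} {t} {u}) f step k≤l)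
    (step l)

-- The relation is left abstract so that directed sets and stages numbered by ℕ are treated alike.
finite-upper-bound : {_∼_ : Rel A r} {D : Pred A p} →
  Satisfiable D →
  (∀ {x y} → x ∈ D → y ∈ D → ∃ λ z → z ∈ D × x ∼ z × y ∼ z) →
  ∀ {n q} {R : Fin n → Pred A q} → (∀ i {x y} → x ∼ y → R i x → R i y) →
  (∀ i → D ≬ R i) → ∃ λ d → d ∈ D × ∀ i → R i d
finite-upper-bound (d , d∈D) ub {zero} up meets = d , d∈D , λ ()
finite-upper-bound sat ub {suc n} up meets =
  let (d , d∈D , Rd) = finite-upper-bound sat ub (up ∘ suc) (meets ∘ suc)
      (e , e∈D , Re) = meets zero
      (z , z∈D , d≤z , e≤z) = ub d∈D e∈D
  in z , z∈D , ∀-cons (up zero e≤z Re) (λ i → up (suc i) d≤z (Rd i))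

-- With s = m + n the value s² + m lies in [s² , (s + 1)²), so it determines s, then m, then n.
pair : ℕ × ℕ → ℕ
pair (m , n) = (m + n) * (m + n) + m

pair-mono-< : ∀ {m n m′ n′} → m + n ℕ.< m′ + n′ → pair (m , n) ℕ.< pair (m′ , n′)
pair-mono-< {m} {n} {m′} {n′} s<s′ = begin-strict
  s * s + m              ≤⟨ ℕ.+-monoʳ-≤ (s * s) (ℕ.m≤m+n m n) ⟩
  s * s + s              ≡⟨ ℕ.+-comm (s * s) s ⟩
  suc s * s              <⟨ ℕ.*-monoʳ-< (suc s) (ℕ.n<1+n s) ⟩
  suc s * suc s          ≤⟨ ℕ.*-mono-≤ s<s′ s<s′ ⟩
  (m′ + n′) * (m′ + n′)  ≤⟨ ℕ.m≤m+n _ m′ ⟩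
  pair (m′ , n′)         ∎
  where
  open ℕ.≤-Reasoning
  s = m + n

pair-injective : ∀ {u v} → pair u ≡ pair v → u ≡ v
pair-injective {m , n} {m′ , n′} eq with ℕ.<-cmp (m + n) (m′ + n′)
... | tri< s<s′ _ _ = contradiction eq (ℕ.<⇒≢ (pair-mono-< {m} {n} {m′} s<s′))
... | tri> _ _ s>s′ = contradiction (sym eq) (ℕ.<⇒≢ (pair-mono-< {m′} {n′} {m} s>s′))
... | tri≈ _ s≡s′ _ = cong₂ _,_ m≡m′
  (ℕ.+-cancelˡ-≡ m n n′ (trans s≡s′ (cong (_+ n′) (sym m≡m′))))
  where
  m≡m′ : m ≡ m′
  m≡m′ = ℕ.+-cancelˡ-≡ ((m + n) * (m + n)) m m′
           (trans eq (cong (λ s → s * s + m′) (sym s≡s′)))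

ℕ×ℕ-countable : Countable (setoid (ℕ × ℕ))
ℕ×ℕ-countable = record
  { to = pair ; cong = cong pair ; injective = pair-injective }

-- Countable complete families.

module CompleteFamily (em : ∀ {a} → ExcludedMiddle a) {ℓ} (P : DCPO ℓ)
                      (good : IsCountableMeetContinuousLDCPO P) where

  open DCPO P renaming (refl to ≤-refl; trans to ≤-trans)
  open IsCountableMeetContinuousLDCPO good
  open Injection countable using () renaming (to to code; injective to code-injective)

  dne : {B : Set p} → ¬ ¬ B → B
  dne = decidable-stable em

  -- Makes principal ideals closed, so that meet-continuity tested against ↓u puts b below every
  -- upper bound u of ↓b ∩ ↓D.
  ∁↓-open : ∀ s → ∁ (↓_ poset s) ∈ σ P
  ∁↓-open s =
    (λ x≤y x≰s y≤s → x≰s (≤-trans x≤y y≤s)) ,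
    λ D dir ⋁D≰s → dne λ disjoint → ⋁D≰s (proj₂ (proj₂ (dirSup D dir))
      λ a∈D → dne λ a≰s → disjoint (_ , a∈D , a≰s))

  module _ (D : Pred Carrier ℓ) (dir : IsDirected poset D) where

    Below : Carrier → Carrier → Pred Carrier ℓ
    Below g b e = g ≤ e × e ≤ b × e ∈ ↓ˢ_ poset D

    ↓∩↓-directed : ∀ {b y z} → b ≤ ⋁ D dir →
                   y ≤ b → y ∈ ↓ˢ_ poset D → z ≤ b → z ∈ ↓ˢ_ poset D →
                   ∃ λ w → w ≤ b × w ∈ ↓ˢ_ poset D × y ≤ w × z ≤ w
    ↓∩↓-directed {b} b≤x y≤b (d₁ , d₁∈D , y≤d₁) z≤b (d₂ , d₂∈D , z≤d₂) =
      let (d , d∈D , d₁≤d , d₂≤d) = proj₂ dir d₁∈D d₂∈D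
          d≤x = proj₁ (proj₂ (dirSup D dir)) d∈D
          -- The meet of b and d, which exists because both lie in ↓(⋁D).
          ((m , m≤x) , lower , greatest) =
            proj₂ (isLDCPO (⋁ D dir) (λ u → proj₁ u ≡ b ⊎ proj₁ u ≡ d))
          below-m : ∀ {v} → v ≤ b → v ≤ d → v ≤ m
          below-m v≤b v≤d = greatest {_ , ≤-trans v≤b b≤x}
            λ { (inj₁ refl) → v≤b ; (inj₂ refl) → v≤d }
      in m , lower {b , b≤x} (inj₁ refl) , (d , d∈D , lower {d , d≤x} (inj₂ refl)) ,
         below-m y≤b (≤-trans y≤d₁ d₁≤d) , below-m z≤b (≤-trans z≤d₂ d₂≤d)

    module _ {g b} (b≤x : b ≤ ⋁ D dir) (g≤b : g ≤ b) (g∈↓D : g ∈ ↓ˢ_ poset D) where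

      Below-directed : IsDirected poset (Below g b)
      Below-directed =
        (g , ≤-refl , g≤b , g∈↓D) ,
        λ { (g≤y , y≤b , y∈↓D) (_ , z≤b , z∈↓D) →
            let (w , w≤b , w∈↓D , y≤w , z≤w) = ↓∩↓-directed b≤x y≤b y∈↓D z≤b z∈↓D
            in w , (≤-trans g≤y y≤w , w≤b , w∈↓D) , y≤w , z≤w }

      Below-sup : IsSup poset (Below g b) b
      Below-sup =
        (λ { (_ , e≤b , _) → e≤b }) ,
        -- It suffices that u bounds all of ↓b ∩ ↓D; directedness moves each y there up to some w
        -- that is also above g.
        λ {u} ub → meetContinuous b D dir b≤x (↓_ poset u) (∁↓-open u)
          λ { (y≤b , y∈↓D) →
              let (w , w≤b , w∈↓D , y≤w , g≤w) = ↓∩↓-directed b≤x y≤b y∈↓D g≤b g∈↓D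
              in ≤-trans y≤w (ub (g≤w , w≤b , w∈↓D)) }

    module _ {V : Pred Carrier ℓ} where

      record Interval : Set ℓ where
        field
          {lower upper} : Carrier
          lower≤upper   : lower ≤ upper
          upper≤x       : upper ≤ ⋁ D dir
          lower∈↓D      : lower ∈ ↓ˢ_ poset D
          upper∈V       : upper ∈ V

      open Interval

      _⊒_ : Rel Interval ℓ
      s ⊒ t = lower s ≤ lower t × upper t ≤ upper s

      Tight : Interval → Set ℓ
      Tight s = ∀ c → lower s ≤ c → c ≤ upper s → c ∈ V → upper s ≤ c

      Outside : Carrier → Interval → Set ℓ
      Outside q t = ¬ (lower t ≤ q × q ≤ upper t)

      module _ (¬tight : ∀ s → ¬ Tight s) where

        -- Failure of tightness gives c ∈ V in the interval [g , b] with b ≰ c. If q ≰ c, then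
        -- [g , c] avoids q. If q ≤ c, then c cannot bound `Below g b`, whose supremum is b, and
        -- [e , b] avoids q for any e ≰ c in it.
        split : ∀ s q → ∃ λ t → s ⊒ t × Outside q t
        split s q = dne λ none → ¬tight s λ c g≤c c≤b c∈V → dne λ b≰c →
          none (cut c g≤c c≤b c∈V b≰c)
          where
          cut : ∀ c → lower s ≤ c → c ≤ upper s → c ∈ V → ¬ upper s ≤ c →
                ∃ λ t → s ⊒ t × Outside q t
          cut c g≤c c≤b c∈V b≰c with em {P = q ≤ c}
          ... | no q≰c =
            record { lower≤upper = g≤c ; upper≤x = ≤-trans c≤b (upper≤x s)
                   ; lower∈↓D = lower∈↓D s ; upper∈V = c∈V } ,
            (≤-refl , c≤b) , λ { (_ , q≤c) → q≰c q≤c }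
          ... | yes q≤c = dne λ none →
            b≰c (proj₂ (Below-sup (upper≤x s) (lower≤upper s) (lower∈↓D s))
              λ { (g≤e , e≤b , e∈↓D) → dne λ e≰c → none
                  ( record { lower≤upper = e≤b ; upper≤x = upper≤x s
                           ; lower∈↓D = e∈↓D ; upper∈V = upper∈V s }
                  , (g≤e , ≤-refl)
                  , λ { (e≤q , _) → e≰c (≤-trans e≤q q≤c) }) })

        avoid : ∀ k s → ∃ λ t → s ⊒ t × (∀ {q} → code q ≡ k → Outside q t)
        avoid k s with em {P = ∃ λ q → code q ≡ k}
        -- A number that codes no element leaves the interval as it is.
        ... | no none = s , (≤-refl , ≤-refl) , λ eq → contradiction (_ , eq) none
        ... | yes (q , eq) =
          let (t , s⊒t , out) = split s q
          in t , s⊒t , λ eq′ (l≤q′ , q′≤u) →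
               let q≈q′ = code-injective (trans eq (sym eq′))
               in out (≤-trans l≤q′ (reflexive (Eq.sym q≈q′)) ,
                       ≤-trans (reflexive q≈q′) q′≤u)

        no-interval : ¬ Interval
        -- The interval numbered `suc (code z)` was chosen to exclude z, yet z lies above all lower
        -- ends and below all upper ends.
        no-interval s₀ = proj₂ (proj₂ (avoid (code z) (nested (code z)))) refl
          ( proj₁ z-sup (suc (code z) , refl)
          , proj₂ z-sup λ { (k , refl) → lower≤upper′ k (suc (code z)) })
          where
          nested : ℕ → Interval
          nested zero    = s₀
          nested (suc k) = proj₁ (avoid k (nested k))

          nested-⊒ : ∀ {k l} → k ℕ.≤ l → nested k ⊒ nested l
          nested-⊒ k≤l = step-monotone _⊒_ (≤-refl , ≤-refl)
            (λ { (l≤l′ , u′≤u) (l′≤l″ , u″≤u′) → ≤-trans l≤l′ l′≤l″ , ≤-trans u″≤u′ u′≤u })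
            nested (λ k → proj₁ (proj₂ (avoid k (nested k)))) (≤⇒≤′ k≤l)

          lower≤upper′ : ∀ k l → lower (nested k) ≤ upper (nested l)
          lower≤upper′ k l =
            ≤-trans (proj₁ (nested-⊒ (m≤m⊔n k l)))
              (≤-trans (lower≤upper (nested (k ⊔ l))) (proj₂ (nested-⊒ (m≤n⊔m k l))))

          Lowers : Pred Carrier ℓ
          Lowers y = ∃ λ k → y ≡ lower (nested k)

          Lowers-directed : IsDirected poset Lowers
          Lowers-directed = (_ , 0 , refl) , λ { (k , refl) (l , refl) →
            _ , (k ⊔ l , refl) , proj₁ (nested-⊒ (m≤m⊔n k l)) , proj₁ (nested-⊒ (m≤n⊔m k l)) }

          z : Carrier
          z = ⋁ Lowers Lowers-directed

          z-sup : IsSup poset Lowers z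
          z-sup = proj₂ (dirSup Lowers Lowers-directed)

      tight-interval : Interval → ∃ Tight
      tight-interval s = dne λ none → no-interval (λ t tight → none (t , tight)) s

  -- Mentions neither D nor V, so one set chosen for (g , b) serves all D and V at once; this makes
  -- countably many sets enough.
  Approaches : Carrier → Carrier → Pred Carrier ℓ → Set ℓ
  Approaches g b E = IsSup poset E b × (∀ {e} → e ∈ E → g ≤ e × ¬ b ≤ e)

  -- Indexed by codes, since the index type of the family must live in `Set` while `Carrier` lives
  -- in `Set ℓ`.
  choose : ∀ i → ∃ λ (F : ∃ (IsDirected poset)) →
           ∀ {g b E} → (code g , code b) ≡ i → IsDirected poset E →
           Approaches g b E → Approaches g b (proj₁ F)
  choose i with em {P = ∃ λ ((g , b) : Carrier × Carrier) → (code g , code b) ≡ i ×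
                       ∃ λ E → IsDirected poset E × Approaches g b E}
  ... | no none =
    -- An arbitrary singleton: the promise about it is vacuous.
    ((_≡ nonempty) , (_ , refl) , λ { refl refl → _ , refl , ≤-refl , ≤-refl }) ,
    λ eq dir app → contradiction (_ , eq , _ , dir , app) none
  ... | yes ((g , b) , eq , E , dir , (ub , least) , strict) =
    (E , dir) , λ eq′ _ _ →
      let g≈g′ = code-injective (cong proj₁ (trans eq (sym eq′)))
          b≈b′ = code-injective (cong proj₂ (trans eq (sym eq′)))
      in ( (λ e∈E → ≤-trans (ub e∈E) (reflexive b≈b′))
         , λ ub′ → ≤-trans (reflexive (Eq.sym b≈b′)) (least ub′)) ,
         λ e∈E → ≤-trans (reflexive (Eq.sym g≈g′)) (proj₁ (strict e∈E)) ,
                 λ b′≤e → proj₂ (strict e∈E) (≤-trans (reflexive b≈b′) b′≤e)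

  family : ℕ × ℕ → ∃ (IsDirected poset)
  family i = proj₁ (choose i)

  family-complete : IsCompleteForScottOpenness P family
  family-complete V V-upper = mk⇔ (λ V∈σ i → proj₂ V∈σ _ _) λ meets →
    (λ {_} {_} → V-upper) , λ D dir ⋁D∈V → dne (escape meets D dir ⋁D∈V)
    where
    escape : (∀ i → let (D , dir) = family i in ⋁ D dir ∈ V → D ≬ V) →
             ∀ D (dir : IsDirected poset D) → ⋁ D dir ∈ V → ¬ ¬ (D ≬ V)
    escape meets D dir@((d , d∈D) , _) ⋁D∈V disjoint =
      -- Tightness forces any e ∈ V in the interval up to `upper`, which members of E never reach.
      b≰e (tight e g≤e (proj₁ b-sup e∈E) e∈V)
      where
      found = tight-interval D dir {V} record
        { lower≤upper = proj₁ (proj₂ (dirSup D dir)) d∈D ; upper≤x = ≤-refl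
        ; lower∈↓D = d , d∈D , ≤-refl ; upper∈V = ⋁D∈V }
      tight = proj₂ found
      open Interval (proj₁ found)

      not-reached : ∀ {e} → e ∈ Below D dir lower upper → lower ≤ e × ¬ upper ≤ e
      not-reached (g≤e , _ , (d , d∈D , e≤d)) =
        g≤e , λ b≤e → disjoint (d , d∈D , V-upper (≤-trans b≤e e≤d) upper∈V)

      i : ℕ × ℕ
      i = code lower , code upper

      E : Pred Carrier ℓ
      E = proj₁ (family i)

      approaches : Approaches lower upper E
      -- `Below` only proves that a suitable set exists for this pair; the chosen E may be a
      -- different one.
      approaches = proj₂ (choose i) refl
        (Below-directed D dir upper≤x lower≤upper lower∈↓D)
        (Below-sup D dir upper≤x lower≤upper lower∈↓D , not-reached)

      b-sup = proj₁ approaches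

      E≬V : E ≬ V
      E≬V = meets i (V-upper (proj₂ b-sup (proj₁ (proj₂ (dirSup E _)))) upper∈V)

      e   = proj₁ E≬V
      e∈E = proj₁ (proj₂ E≬V)
      e∈V = proj₂ (proj₂ E≬V)
      g≤e = proj₁ (proj₂ approaches e∈E)
      b≰e = proj₂ (proj₂ approaches e∈E)

  hasCountableCompleteFamily : HasCountableCompleteFamily P
  hasCountableCompleteFamily = (ℕ × ℕ) , ℕ×ℕ-countable , family , family-complete

-- Coordinate updates and finitely generated boxes.

module _ {X : Fin n → Set a} where

  update : ∀ i → X i → (∀ j → X j) → ∀ j → X j
  update i u y j with i ≟ j
  ... | yes refl = u
  ... | no  _    = y j

  update-elim : ∀ {i u y} (R : ∀ j → Pred (X j) r) → R i u →
                (∀ j → i ≢ j → R j (y j)) → ∀ j → R j (update i u y j)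
  update-elim {i = i} R Ru Ry j with i ≟ j
  ... | yes refl = Ru
  ... | no  i≢j  = Ry j i≢j

  update-at : ∀ i {u y} → update i u y i ≡ u
  update-at i with i ≟ i
  ... | yes refl = refl
  ... | no  i≢i  = contradiction refl i≢i

  update-away : ∀ {i j u y} → i ≢ j → update i u y j ≡ y j
  update-away {i = i} {j} i≢j with i ≟ j
  ... | yes i≡j = contradiction i≡j i≢j
  ... | no  _   = refl

module _ {ℓ} (Q : Poset ℓ ℓ ℓ) where
  open Poset Q

  ↑ˡ : List Carrier → Pred Carrier ℓ
  ↑ˡ xs y = Any (_≤ y) xs

Box : ∀ {ℓ n} (Q : Fin n → Poset ℓ ℓ ℓ) → (∀ i → List (Poset.Carrier (Q i))) →
      Pred (∀ i → Poset.Carrier (Q i)) ℓ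
Box Q A y = ∀ i → y i ∈ ↑ˡ (Q i) (A i)

-- The tube lemma for a finitely generated box.
uniform-on-box : {_∼_ : Rel A r} {D : Pred A p} →
  Satisfiable D →
  (∀ {x y} → x ∈ D → y ∈ D → ∃ λ z → z ∈ D × x ∼ z × y ∼ z) →
  ∀ {n ℓ q} (Q : Fin n → Poset ℓ ℓ ℓ) (B : ∀ i → List (Poset.Carrier (Q i)))
  (Φ : A → Pred (∀ i → Poset.Carrier (Q i)) q) →
  (∀ {d e y} → d ∼ e → Φ d y → Φ e y) →
  (∀ {d y z} → (∀ i → Poset._≤_ (Q i) (y i) (z i)) → Φ d y → Φ d z) →
  (∀ y → y ∈ Box Q B → D ≬ λ d → Φ d y) →
  ∃ λ d → d ∈ D × Box Q B ⊆ Φ d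
uniform-on-box sat ub {zero} Q B Φ up-d up-y meets =
  let (d , d∈D , Φd) = meets (λ ()) (λ ()) in d , d∈D , λ _ → up-y (λ ()) Φd
uniform-on-box sat ub {suc n} Q B Φ up-d up-y meets =
  -- Fix each of the finitely many generators as head, treat the tail by induction, and take one
  -- member of D above the resulting witnesses.
  let (d , d∈D , Φd) = finite-upper-bound sat ub
        {R = λ k d → Box (Q ∘ suc) (B ∘ suc) ⊆ λ y → Φ d (∀-cons (lookup (B zero) k) y)}
        (λ k d∼e Φd y∈ → up-d d∼e (Φd y∈))
        (λ k → uniform-on-box sat ub (Q ∘ suc) (B ∘ suc)
          (λ d y → Φ d (∀-cons (lookup (B zero) k) y))
          up-d
          (λ y≤z → up-y (∀-cons (Poset.refl (Q zero)) y≤z))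
          (λ y y∈ → meets _ (∀-cons
            (Any.map (λ eq → Poset.reflexive (Q zero) (Poset.Eq.reflexive (Q zero) (sym eq)))
                     (∈-lookup k))
            y∈)))
  in d , d∈D , λ y∈ → up-y
       (∀-cons (lookup-index (y∈ zero)) (λ i → Poset.refl (Q (suc i))))
       (Φd (index (y∈ zero)) (y∈ ∘ suc))

-- The two topologies on a finite product.

module _ {ℓ} (P : Fin n → DCPO ℓ) where

  product⊆σ : productTopology (λ i → σ (P i)) ⊆ σ (∏ P)
  product⊆σ W-open =
    (λ x≤y x∈W → let (V , V-open , x∈V , box) = W-open x∈W in
      box λ i → proj₁ (V-open i) (x≤y i) (x∈V i)) ,
    λ D dir ⋁D∈W →
      let (V , V-open , ⋁D∈V , box) = W-open ⋁D∈W
          (d , d∈D , d∈V) = finite-upper-bound (proj₁ dir) (proj₂ dir) {R = λ i d → d i ∈ V i}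
            (λ i x≤y → proj₁ (V-open i) (x≤y i))
            (λ i → let (_ , (d , d∈D , d≡) , v) = proj₂ (V-open i) _ _ (⋁D∈V i)
                   in d , d∈D , subst (V i) (sym d≡) v)
      in d , d∈D , box d∈V

module ProductOpens (em : ∀ {a} → ExcludedMiddle a) {ℓ} (P : Fin n → DCPO ℓ)
                    (families : ∀ i → HasCountableCompleteFamily (P i))
                    {W} (W-open : W ∈ σ (∏ P)) where

  private
    Q : Fin n → Poset ℓ ℓ ℓ
    Q i = DCPO.poset (P i)

    module Q i = Poset (Q i)

    Index : Fin n → Set
    Index i = proj₁ (families i)

    countable : ∀ i → Countable (setoid (Index i))
    countable i = proj₁ (proj₂ (families i))

    code : ∀ i → Index i → ℕ
    code i = Injection.to (countable i)

    𝒟 : ∀ i → Index i → ∃ (IsDirected (Q i))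
    𝒟 i = proj₁ (proj₂ (proj₂ (families i)))

    sup : ∀ i → Index i → Q.Carrier i
    sup i j = DCPO.⋁ (P i) (proj₁ (𝒟 i j)) (proj₂ (𝒟 i j))

  update-mono : ∀ {i d e y z} → Q._≤_ i d e → (∀ j → Q._≤_ j (y j) (z j)) →
                ∀ j → Q._≤_ j (update i d y j) (update i e z j)
  update-mono {i} {d} {e} {y} {z} d≤e y≤z = update-elim (λ j u → Q._≤_ j u (update i e z j))
    (subst (Q._≤_ i d) (sym (update-at i)) d≤e)
    (λ j i≢j → subst (Q._≤_ j (y j)) (sym (update-away i≢j)) (y≤z j))

  -- Inserting d into coordinate i of y preserves directed suprema: coordinate i of ⋁E bounds D, and
  -- its other coordinates bound those of y because D is nonempty.
  slice-open : ∀ i {y} D (dir : IsDirected (Q i) D) →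
               update i (DCPO.⋁ (P i) D dir) y ∈ W → D ≬ λ d → update i d y ∈ W
  slice-open i {y} D ((d₀ , d₀∈D) , ub) ⋁D∈W =
    let (_ , (d , d∈D , w≡) , w∈W) = proj₂ W-open E E-directed (proj₁ W-open ⋁D≤⋁E ⋁D∈W)
    in d , d∈D , subst W w≡ w∈W
    where
    E : Pred (∀ j → Q.Carrier j) ℓ
    E w = ∃ λ d → d ∈ D × w ≡ update i d y

    E-directed : IsDirected (DCPO.poset (∏ P)) E
    E-directed = (_ , d₀ , d₀∈D , refl) , λ { (d , d∈D , refl) (e , e∈D , refl) →
      let (z , z∈D , d≤z , e≤z) = ub d∈D e∈D
      in _ , (z , z∈D , refl) , update-mono d≤z (λ j → Q.refl j) , update-mono e≤z (λ j → Q.refl j) }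

    ⋁E : ∀ j → Q.Carrier j
    ⋁E = DCPO.⋁ (∏ P) E E-directed

    below-⋁E : ∀ {d} → d ∈ D → ∀ j → Q._≤_ j (update i d y j) (⋁E j)
    below-⋁E d∈D = proj₁ (proj₂ (DCPO.dirSup (∏ P) E E-directed)) (_ , d∈D , refl)

    ⋁D≤⋁E : ∀ j → Q._≤_ j (update i (DCPO.⋁ (P i) D _) y j) (⋁E j)
    ⋁D≤⋁E = update-elim (λ j u → Q._≤_ j u (⋁E j))
      (proj₂ (proj₂ (DCPO.dirSup (P i) D _))
        λ d∈D → subst (λ u → Q._≤_ i u (⋁E i)) (update-at i) (below-⋁E d∈D i))
      (λ j i≢j → subst (λ u → Q._≤_ j u (⋁E j)) (update-away i≢j) (below-⋁E d₀∈D j))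

  record Stage : Set ℓ where
    field
      points : ∀ i → List (Q.Carrier i)
      inside : Box Q points ⊆ W

    ↑pts : ∀ i → Pred (Q.Carrier i) ℓ
    ↑pts i = ↑ˡ (Q i) (points i)

  open Stage

  _⊑_ : Rel Stage ℓ
  s ⊑ t = ∀ i → ↑pts s i ⊆ ↑pts t i

  ⊑-trans : ∀ {s t u} → s ⊑ t → t ⊑ u → s ⊑ u
  ⊑-trans s⊑t t⊑u i = t⊑u i ∘ s⊑t i

  -- A request carries a number rather than an index so that requests can be listed; a k that codes
  -- no index asks for nothing.
  Serves : Stage → Stage → Fin n × ℕ → Set ℓ
  Serves s t (i , k) =
    ∀ {j} → code i j ≡ k → sup i j ∈ ↑pts s i → proj₁ (𝒟 i j) ≬ ↑pts t i

  -- Putting ⋁D into coordinate i of a point y of the box stays in the box, hence in W, so some d ∈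
  -- D can replace it. The tube lemma makes d independent of y.
  add-point : ∀ s i D (dir : IsDirected (Q i) D) → DCPO.⋁ (P i) D dir ∈ ↑pts s i →
              ∃ λ t → s ⊑ t × D ≬ ↑pts t i
  add-point s i D dir ⋁D∈ = t ,
    update-elim {i = i} {u = d ∷ points s i} {y = points s} (λ j xs → ↑pts s j ⊆ ↑ˡ (Q j) xs)
      there (λ _ _ → id) ,
    d , d∈D , subst (λ xs → d ∈ ↑ˡ (Q i) xs) (sym (update-at i)) (here (Q.refl i))
    where
    uniform : ∃ λ d → d ∈ D × Box Q (points s) ⊆ λ y → update i d y ∈ W
    uniform = uniform-on-box (proj₁ dir) (proj₂ dir) Q (points s)
      (λ d y → update i d y ∈ W)
      (λ d≤e → proj₁ W-open (update-mono d≤e λ j → Q.refl j))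
      (λ y≤z → proj₁ W-open (update-mono (Q.refl i) y≤z))
      (λ y y∈ → slice-open i D dir (inside s
        (update-elim (λ j → ↑pts s j) ⋁D∈ (λ j _ → y∈ j))))

    d   = proj₁ uniform
    d∈D = proj₁ (proj₂ uniform)

    new-points : ∀ j → List (Q.Carrier j)
    new-points = update i (d ∷ points s i) (points s)

    old : ∀ {z} → z ∈ Box Q new-points → ∀ j → i ≢ j → z j ∈ ↑pts s j
    old z∈ j i≢j = subst (λ xs → _ ∈ ↑ˡ (Q j) xs) (update-away i≢j) (z∈ j)

    new-inside : Box Q new-points ⊆ W
    new-inside {z} z∈ with subst (λ xs → z i ∈ ↑ˡ (Q i) xs) (update-at i) (z∈ i)
    -- Overwriting coordinate i of z by ⋁D gives a point of the old box; with d there instead, it is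
    -- in W and below z.
    ... | here d≤zᵢ = proj₁ W-open
      (update-elim (λ j u → Q._≤_ j u (z j)) d≤zᵢ
        (λ j i≢j → Q.reflexive j (Q.Eq.reflexive j (update-away i≢j))))
      (proj₂ (proj₂ uniform) (update-elim (λ j → ↑pts s j) ⋁D∈ (old z∈)))
    ... | there zᵢ∈ = inside s in-old
      where
      in-old : ∀ j → z j ∈ ↑pts s j
      in-old j with i ≟ j
      ... | yes refl = zᵢ∈
      ... | no  i≢j  = old z∈ j i≢j

    t : Stage
    t = record { points = new-points ; inside = new-inside }

  serve : ∀ s r → ∃ λ t → s ⊑ t × Serves s t r
  serve s (i , k) with em {P = ∃ λ j → code i j ≡ k × sup i j ∈ ↑pts s i}
  ... | no none = s , (λ _ → id) , λ eq sup∈ → contradiction (_ , eq , sup∈) none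
  ... | yes (j , eq , sup∈) =
    let (t , s⊑t , meets) = add-point s i (proj₁ (𝒟 i j)) (proj₂ (𝒟 i j)) sup∈
    in t , s⊑t , λ eq′ _ → subst (λ j → proj₁ (𝒟 i j) ≬ ↑pts t i)
         (Injection.injective (countable i) (trans eq (sym eq′))) meets

  serve-all : ∀ s rs → ∃ λ t → s ⊑ t × (∀ {r} → r ∈ˡ rs → Serves s t r)
  serve-all s []       = s , (λ _ → id) , λ ()
  serve-all s (r ∷ rs) =
    let (t , s⊑t , serves) = serve s r
        (u , t⊑u , all)    = serve-all t rs
    in u , ⊑-trans {s} {t} {u} s⊑t t⊑u , λ
      -- Stages only grow, so a served request stays served, and a supremum present in s is still
      -- present when its turn comes.
      { (here refl)   eq sup∈ → map₂ (map₂ (t⊑u _)) (serves eq sup∈)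
      ; (there r∈rs)  eq sup∈ → all r∈rs eq (s⊑t _ sup∈) }

  module _ {x} (x∈W : x ∈ W) where

    -- Each (i , k) recurs at every N > k, which catches suprema that enter late.
    requirements : ℕ → List (Fin n × ℕ)
    requirements N = cartesianProduct (allFin n) (upTo N)

    stage : ℕ → Stage
    stage zero    = record
      { points = λ i → [ x i ]
      ; inside = λ y∈ → proj₁ W-open (λ i → singleton⁻ (y∈ i)) x∈W }
    stage (suc N) = proj₁ (serve-all (stage N) (requirements N))

    stage-⊑ : ∀ {M N} → M ℕ.≤ N → stage M ⊑ stage N
    stage-⊑ M≤N = step-monotone _⊑_ (λ _ → id)
      (λ {s} {t} {u} → ⊑-trans {s} {t} {u})
      stage (λ N → proj₁ (proj₂ (serve-all (stage N) (requirements N)))) (≤⇒≤′ M≤N)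

    V : ∀ i → Pred (Q.Carrier i) ℓ
    V i y = ∃ λ N → y ∈ ↑pts (stage N) i

    V-open : ∀ i → V i ∈ σ (P i)
    V-open i = Equivalence.from
      (proj₂ (proj₂ (proj₂ (families i))) (V i)
        λ { y≤z (N , y∈) → N , Any.map (λ d≤y → Q.trans i d≤y y≤z) y∈ })
      λ { j (N , sup∈) →
          -- Late enough to contain the supremum and to list the request; `suc` because `upTo M`
          -- stops before M.
          let M = N ⊔ suc (code i j)
              (d , d∈D , d∈) = proj₂ (proj₂ (serve-all (stage M) (requirements M)))
                (∈-cartesianProduct⁺ (∈-allFin i) (∈-upTo⁺ (m≤n⊔m N (suc (code i j)))))
                refl (stage-⊑ (m≤m⊔n N _) i sup∈)
          in d , d∈D , suc M , d∈ }

    V⊆W : ∀ {y} → (∀ i → y i ∈ V i) → y ∈ W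
    V⊆W {y} y∈V =
      -- Each coordinate of y enters at its own stage; finitely many stages have a common bound.
      let (N , _ , y∈) = finite-upper-bound {_∼_ = ℕ._≤_} {D = U} (0 , tt)
            (λ {M} {N} _ _ → M ⊔ N , tt , m≤m⊔n M N , m≤n⊔m M N)
            {R = λ i N → y i ∈ ↑pts (stage N) i}
            (λ i M≤N → stage-⊑ M≤N i)
            (λ i → let (N , y∈) = y∈V i in N , tt , y∈)
      in inside (stage N) y∈

  σ⊆product : W ∈ productTopology (λ i → σ (P i))
  σ⊆product x∈W =
    V x∈W , V-open x∈W , (λ i → 0 , here (Q.refl i)) , V⊆W x∈W

theorem3p4 : (∀ {a} → ExcludedMiddle a) → ∀ {ℓ : Level} →
    ((P : DCPO ℓ) → IsCountableMeetContinuousLDCPO P → HasCountableCompleteFamily P)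
    ×
    ((n : ℕ) (P : Fin n → DCPO ℓ) → (∀ i → IsCountableMeetContinuousLDCPO (P i)) →
    σ (∏ P) ≐ productTopology (λ i → σ (P i)))
theorem3p4 em = CompleteFamily.hasCountableCompleteFamily em ,
  λ n P good →
    ProductOpens.σ⊆product em P
      (λ i → CompleteFamily.hasCountableCompleteFamily em (P i) (good i)) ,
    product⊆σ P
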